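{- Let $G$ be a finite simple graph on $n$ vertices. Then $G$ admits a strongly-separating path system of size at most $19n$; that is, there exists a collection $\mathcal{P}$ of paths in $G$ with $|\mathcal{P}| \le 19n$ such that for any two distinct edges $e$ and $f$ of $G$ there exist paths $P_e, P_f \in \mathcal{P}$ with $e \in P_e$, $e \notin P_f$, $f \in P_f$ and $f \notin P_e$.
   Context: Graphs are finite, simple and undirected. A path in a graph $G$ is a subgraph of $G$ that is a path (no repeated vertices); paths consisting of a single edge are allowed. For an edge $e$ and a path $P$, $e \in P$ means that $e$ is one of the edges of $P$. A collection $\mathcal{P}$ of paths in $G$ is a strongly-separating path system of $G$ if for any two distinct edges $e$ and $f$ of $G$ there exist paths $P_e$ and $P_f$ in $\mathcal{P}$ such that $e \in P_e$, $e \notin P_f$, $f \in P_f$ and $f \notin P_e$. The size of such a system is the number of paths in the collection. -}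

module Defs where

open import Data.Fin.Base using (Fin)
open import Data.List.Base using (List; []; _∷_)
open import Data.List.Membership.Propositional using (_∈_)
open import Data.List.NonEmpty.Base using (List⁺; toList)
open import Data.List.Relation.Unary.Any using (Any)
open import Data.List.Relation.Unary.Linked using (Linked; []; [-]; _∷_)
open import Data.List.Relation.Unary.Unique.Propositional using (Unique)
open import Data.Nat.Base using (ℕ)
open import Data.Product.Base using (_×_; ∃-syntax)
open import Data.Sum.Base using (_⊎_)
open import Level using (0ℓ)
open import Relation.Binary.Core using (Rel)
open import Relation.Binary.Definitions using (Decidable; Irreflexive; Symmetric)
open import Relation.Binary.PropositionalEquality.Core using (_≡_)
open import Relation.Nullary.Negation.Core using (¬_)

-- Decidability of adjacency is automatic classically; constructively it is
-- what makes the edge set, and not just the vertex set, finite.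
record Graph (n : ℕ) : Set₁ where
  field
    Adj        : Rel (Fin n) 0ℓ
    adj?       : Decidable Adj
    adj-sym    : Symmetric Adj
    adj-irrefl : Irreflexive _≡_ Adj

module _ {n : ℕ} (G : Graph n) where
  open Graph G

  -- Each undirected edge occurs here with both orientations (and possibly
  -- several adjacency proofs), so edges are compared with _≈ₑ_, never _≡_.
  record Edge : Set where
    constructor edge
    field
      src tgt  : Fin n
      adjacent : Adj src tgt

  -- A nonempty list of distinct vertices, consecutive ones adjacent.  A list
  -- and its reversal present the same subgraph.
  record Path : Set where
    constructor path
    field
      vertices : List⁺ (Fin n)
      distinct : Unique (toList vertices)
      linked   : Linked Adj (toList vertices)

module _ {n : ℕ} {G : Graph n} where
  open Graph G

  infix 4 _≈ₑ_ _≉ₑ_ _∈ₚ_ _∉ₚ_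

  _≈ₑ_ : Edge G → Edge G → Set
  edge u v _ ≈ₑ edge x y _ = (u ≡ x × v ≡ y) ⊎ (u ≡ y × v ≡ x)

  _≉ₑ_ : Edge G → Edge G → Set
  e ≉ₑ f = ¬ (e ≈ₑ f)

  linkedEdges : ∀ {vs} → Linked Adj vs → List (Edge G)
  linkedEdges []                 = []
  linkedEdges [-]                = []
  linkedEdges (_∷_ {x} {y} a as) = edge x y a ∷ linkedEdges as

  edges : Path G → List (Edge G)
  edges P = linkedEdges (Path.linked P)

  _∈ₚ_ : Edge G → Path G → Set
  e ∈ₚ P = Any (e ≈ₑ_) (edges P)

  _∉ₚ_ : Edge G → Path G → Set
  e ∉ₚ P = ¬ (e ∈ₚ P)

  -- The length of the list 𝒫 bounds from above the number of different paths
  -- occurring in it.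
  StronglySeparating : List (Path G) → Set
  StronglySeparating 𝒫 =
    ∀ (e f : Edge G) → e ≉ₑ f →
    ∃[ Pᵉ ] ∃[ Pᶠ ]
      (Pᵉ ∈ 𝒫 × Pᶠ ∈ 𝒫 × e ∈ₚ Pᵉ × e ∉ₚ Pᶠ × f ∈ₚ Pᶠ × f ∉ₚ Pᵉ)

{-# OPTIONS --safe #-}

-- Rotate a path until it can no longer be extended.  By Pósa's argument the
-- set S of its endpoints has all its neighbours on the path P, and each of
-- them lies in S or next to S on P.  So every edge at S is an edge of P or
-- a chord joining two of m ≤ 3|S| positions, which we rank along P.
--
-- The chords whose ranks have a given sum are nested, hence a single zigzag
-- runs through all of them, the rest of it following P.  There are two such
-- zigzags, and they share no edge of P.  The chords with a given value of
-- r x + 2 r y (where x lies before y) are nested as well, and the two values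
-- determine the chord.  Thus a chord is the only edge common to both of its
-- zigzags of the first kind and a zigzag of the second kind.
--
-- Zigzags on disjoint intervals of P are joined into one path: this leaves
-- m + 2m paths of the first kind and 2m of the second.  With the at most 2|S|
-- edges of P at S as further paths, 5 · 3|S| + 2|S| = 17|S| paths separate the
-- edges at S from all others, and one continues with G − S.
module Submission where

open import Defs
open import Data.Empty using (⊥; ⊥-elim)
open import Data.Fin.Base using (Fin)
import Data.Fin.Properties as Fin
open import Data.List.Base
  using (List; []; _∷_; _++_; _ʳ++_; map; length; concat; filter; upTo; downFrom; allFin)
import Data.List.Membership.DecPropositional as DecMembership
open import Data.List.Membership.Propositional using (_∈_; _∉_; find; lose)
open import Data.List.Membership.Propositional.Properties
  using (∈-++⁻; ∈-++⁺ˡ; ∈-++⁺ʳ; ∈-∃++; ∈-map⁺; ∈-map⁻; ∈-upTo⁺; ∈-concat⁺′;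
         ∈-filter⁺; ∈-filter⁻; ∈-allFin)
open import Data.List.NonEmpty.Base using (toList) renaming (_∷_ to _∷⁺_)
open import Data.List.Properties
  using (length-++; length-map; length-upTo; length-tabulate; filter-accept)
open import Data.List.Relation.Binary.Permutation.Propositional
  using (_↭_; ↭-refl; ↭-sym; ↭-trans; ↭⇒↭ₛ)
open import Data.List.Relation.Binary.Permutation.Propositional.Properties
  using (shift; ∈-resp-↭; ↭-length; ++↭ʳ++)
open import Data.List.Relation.Binary.Permutation.Setoid.Properties using (Unique-resp-↭)
open import Data.List.Relation.Binary.Subset.Propositional using (_⊆_)
open import Data.List.Relation.Unary.All as All using (All; []; _∷_)
import Data.List.Relation.Unary.All.Properties as All
open import Data.List.Relation.Unary.AllPairs using ([]; _∷_)
open import Data.List.Relation.Unary.Any as Any using (Any; here; there)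
open import Data.List.Relation.Unary.Linked using (Linked; []; [-]; _∷_)
open import Data.List.Relation.Unary.Unique.Propositional using (Unique)
import Data.List.Relation.Unary.Unique.Propositional.Properties as Unique
open import Data.Nat.Base
open import Data.Nat.Properties
open import Data.Product.Base as Product
  using (Σ; Σ-syntax; _×_; _,_; ∃-syntax; ∃₂; proj₁; proj₂)
open import Data.Sum.Base as Sum using (_⊎_; inj₁; inj₂; [_,_]′)
open import Function.Base using (_∘_; id)
open import Relation.Binary.Definitions using (Decidable; DecidableEquality; tri<; tri≈; tri>)
open import Relation.Binary.PropositionalEquality hiding (J)
open import Relation.Nullary using (¬_; Dec; yes; no; ¬?; _×-dec_; _⊎-dec_)
import Relation.Nullary.Decidable as Dec

-- Consecutive entries of lists.

private
  variable
    A B : Set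
    d u u′ v v′ w x y : A
    xs ys zs : List A
    i j lo hi : ℕ

-- Edges are undirected, so a pair counts in either order.
data Consec {A : Set} (u v : A) : List A → Set where
  here   : Consec u v (u ∷ v ∷ xs)
  here⁻¹ : Consec u v (v ∷ u ∷ xs)
  there  : Consec u v xs → Consec u v (x ∷ xs)

-- The pair at which xs ʳ++ ys passes from the reversal of xs to ys.
data Junction {A : Set} (u v : A) : List A → List A → Set where
  junction   : Junction u v (u ∷ xs) (v ∷ ys)
  junction⁻¹ : Junction u v (v ∷ xs) (u ∷ ys)

Links : (A → A → Set) → List A → Set
Links R xs = ∀ {u v} → Consec u v xs → R u v

SamePair : A → A → A → A → Set
SamePair u v x y = (u ≡ x × v ≡ y) ⊎ (u ≡ y × v ≡ x)

Consec-sym : Consec u v xs → Consec v u xs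
Consec-sym here      = here⁻¹
Consec-sym here⁻¹    = here
Consec-sym (there c) = there (Consec-sym c)

SamePair-swap : SamePair u v x y → SamePair v u x y
SamePair-swap (inj₁ (p , q)) = inj₂ (q , p)
SamePair-swap (inj₂ (p , q)) = inj₁ (q , p)

Consec-∈ˡ : Consec u v xs → u ∈ xs
Consec-∈ˡ here      = here refl
Consec-∈ˡ here⁻¹    = there (here refl)
Consec-∈ˡ (there c) = there (Consec-∈ˡ c)

Consec-∈ʳ : Consec u v xs → v ∈ xs
Consec-∈ʳ = Consec-∈ˡ ∘ Consec-sym

Consec-∷⁻ : Consec u v (x ∷ xs) →
            (∃₂ λ y ys → xs ≡ y ∷ ys × SamePair u v x y) ⊎ Consec u v xs
Consec-∷⁻ here      = inj₁ (_ , _ , refl , inj₁ (refl , refl))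
Consec-∷⁻ here⁻¹    = inj₁ (_ , _ , refl , inj₂ (refl , refl))
Consec-∷⁻ (there c) = inj₂ c

Consec-++⁺ˡ : Consec u v xs → Consec u v (xs ++ ys)
Consec-++⁺ˡ here      = here
Consec-++⁺ˡ here⁻¹    = here⁻¹
Consec-++⁺ˡ (there c) = there (Consec-++⁺ˡ c)

Consec-++⁺ʳ : ∀ xs → Consec u v ys → Consec u v (xs ++ ys)
Consec-++⁺ʳ []       c = c
Consec-++⁺ʳ (_ ∷ xs) c = there (Consec-++⁺ʳ xs c)

Consec-ʳ++⁺ʳ : ∀ xs → Consec u v ys → Consec u v (xs ʳ++ ys)
Consec-ʳ++⁺ʳ []       c = c
Consec-ʳ++⁺ʳ (_ ∷ xs) c = Consec-ʳ++⁺ʳ xs (there c)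

Consec-ʳ++⁺ˡ : Consec u v xs → Consec u v (xs ʳ++ ys)
Consec-ʳ++⁺ˡ {xs = _ ∷ _ ∷ xs} here = Consec-ʳ++⁺ʳ xs here⁻¹
Consec-ʳ++⁺ˡ {xs = _ ∷ _ ∷ xs} here⁻¹ = Consec-ʳ++⁺ʳ xs here
Consec-ʳ++⁺ˡ (there c) = Consec-ʳ++⁺ˡ c

Consec-ʳ++⁻ : ∀ xs → Consec u v (xs ʳ++ ys) →
              Consec u v xs ⊎ Consec u v ys ⊎ Junction u v xs ys
Consec-ʳ++⁻ []       c = inj₂ (inj₁ c)
Consec-ʳ++⁻ (x ∷ xs) c with Consec-ʳ++⁻ xs c
... | inj₁ c′                 = inj₁ (there c′)
... | inj₂ (inj₁ here)        = inj₂ (inj₂ junction)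
... | inj₂ (inj₁ here⁻¹)      = inj₂ (inj₂ junction⁻¹)
... | inj₂ (inj₁ (there c′))  = inj₂ (inj₁ c′)
... | inj₂ (inj₂ junction)    = inj₁ here⁻¹
... | inj₂ (inj₂ junction⁻¹)  = inj₁ here

Junction-∈ : Junction u v xs ys → (u ∈ xs × v ∈ ys) ⊎ (v ∈ xs × u ∈ ys)
Junction-∈ junction   = inj₁ (here refl , here refl)
Junction-∈ junction⁻¹ = inj₂ (here refl , here refl)

∈-ʳ++⁻ : ∀ xs → x ∈ xs ʳ++ ys → x ∈ xs ⊎ x ∈ ys
∈-ʳ++⁻ xs x∈ = ∈-++⁻ xs (∈-resp-↭ (↭-sym (++↭ʳ++ xs _)) x∈)

Consec-map⁺ : (f : A → B) → Consec u v xs → Consec (f u) (f v) (map f xs)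
Consec-map⁺ f here      = here
Consec-map⁺ f here⁻¹    = here⁻¹
Consec-map⁺ f (there c) = there (Consec-map⁺ f c)

Consec-map⁻ : (f : A → B) {a b : B} → ∀ xs → Consec a b (map f xs) →
              ∃₂ λ u v → a ≡ f u × b ≡ f v × Consec u v xs
Consec-map⁻ f (x ∷ [])     (there ())
Consec-map⁻ f (x ∷ y ∷ xs) here = x , y , refl , refl , here
Consec-map⁻ f (x ∷ y ∷ xs) here⁻¹ = y , x , refl , refl , here⁻¹
Consec-map⁻ f (x ∷ y ∷ xs) (there c) =
  let u , v , p , q , c′ = Consec-map⁻ f (y ∷ xs) c in u , v , p , q , there c′

Links⇒Linked : {R : A → A → Set} → ∀ xs → Links R xs → Linked R xs
Links⇒Linked []           l = []
Links⇒Linked (x ∷ [])     l = [-]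
Links⇒Linked (x ∷ y ∷ xs) l = l here ∷ Links⇒Linked (y ∷ xs) (l ∘ there)

Consec? : DecidableEquality A → ∀ (u v : A) xs → Dec (Consec u v xs)
Consec? _≟_ u v []           = no λ ()
Consec? _≟_ u v (x ∷ [])     = no λ { (there ()) }
Consec? _≟_ u v (x ∷ y ∷ xs) =
  Dec.map′ (λ { (inj₁ (inj₁ (refl , refl))) → here
              ; (inj₁ (inj₂ (refl , refl))) → here⁻¹
              ; (inj₂ c)                    → there c })
           (λ { here      → inj₁ (inj₁ (refl , refl))
              ; here⁻¹    → inj₁ (inj₂ (refl , refl))
              ; (there c) → inj₂ c })
           (((u ≟ x ×-dec v ≟ y) ⊎-dec (u ≟ y ×-dec v ≟ x)) ⊎-dec Consec? _≟_ u v (y ∷ xs))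

-- Lists without repetition and their lengths.

Unique-↭ : xs ↭ ys → Unique xs → Unique ys
Unique-↭ p = Unique-resp-↭ (setoid _) (↭⇒↭ₛ p)

-- Pigeonhole principle: delete one occurrence of the head of `xs` from `ys`; the tail of `xs`
-- avoids the head and so still lies in the rest.
Unique-⊆-length : Unique xs → xs ⊆ ys → length xs ≤ length ys
Unique-⊆-length {xs = []} _ _ = z≤n
Unique-⊆-length {xs = x ∷ xs} {ys = ys} (x∉xs ∷ u) sub with ∈-∃++ (sub (here refl))
... | as , bs , refl = subst (suc (length xs) ≤_) (sym (↭-length (shift x as bs)))
                         (s≤s (Unique-⊆-length u sub′))
  where
  sub′ : xs ⊆ as ++ bs
  sub′ z∈xs with ∈-resp-↭ (shift x as bs) (sub (there z∈xs))
  ... | here refl = ⊥-elim (All.lookup x∉xs z∈xs refl)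
  ... | there z∈  = z∈

length-concat-map : ∀ k (f : A → List B) → (∀ x → length (f x) ≡ k) →
                    ∀ xs → length (concat (map f xs)) ≡ k * length xs
length-concat-map k f len []       = sym (*-zeroʳ k)
length-concat-map k f len (x ∷ xs) = trans (length-++ (f x))
  (trans (cong₂ _+_ (len x) (length-concat-map k f len xs)) (sym (*-suc k (length xs))))

Unique-length≤ : ∀ {n} {xs : List (Fin n)} → Unique xs → length xs ≤ n
Unique-length≤ {n} u =
  ≤-trans (Unique-⊆-length u (λ {i} _ → ∈-allFin i)) (≤-reflexive (length-tabulate {n = n} id))

-- Pósa rotations

-- Here `t` is the last entry of `s ∷ xs`. A rotation along a chord from `s` to `w` reverses this
-- prefix, so `t` becomes the new endpoint and loses its link to `w`.
rotate-head : ∀ (s : A) xs →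
              ∃[ t ] (∀ zs → ∃[ rest ] (s ∷ xs) ʳ++ zs ≡ t ∷ rest) ×
                     (∀ w ys → Consec w t ((s ∷ xs) ++ w ∷ ys))
rotate-head s []       = s , (λ zs → zs , refl) , λ w ys → here⁻¹
rotate-head s (x ∷ xs) with rotate-head x xs
... | t , head , consec = t , (λ zs → head (s ∷ zs)) , λ w ys → there (consec w ys)

module _ {n : ℕ} (G : Graph n) where
  open Graph G
  open DecMembership (Fin._≟_ {n}) using (_∈?_)

  private V = Fin n

  Near : List V → List V → V → Set
  Near P S w = w ∈ P × (w ∈ S ⊎ Any (λ t → Consec w t P) S)

  near? : ∀ P S w → Dec (Near P S w)
  near? P S w = (w ∈? P) ×-dec ((w ∈? S) ⊎-dec Any.any? (λ t → Consec? Fin._≟_ w t P) S)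

  -- The invariant of Pósa's argument (faithful) is that rotations only change
  -- the neighbourhoods of vertices in S or next to S on P.
  record Rotated (P S : List V) (s : V) : Set where
    field
      rest     : List V
      perm     : s ∷ rest ↭ P
      links    : Links Adj (s ∷ rest)
      faithful : w ∉ S → (∀ {z} → Consec w z P → z ∉ S) →
                 ∀ {z} → Consec w z (s ∷ rest) → Consec w z P

  -- A path on which neither an extension nor a rotation makes progress, as expressed by `closed`.
  -- `A` holds the vertices still to be treated, and `P⊆A` keeps `S` among them.
  record Expansion (A : List V) : Set where
    field
      P S      : List V
      P-unique : Unique P
      P-links  : Links Adj P
      P⊆A      : P ⊆ A
      S-unique : Unique S
      S-filled : 0 < length S
      S⊆P      : S ⊆ P
      closed   : u ∈ S → Adj u v → Near P S v

  module _ {A : List V} (Adj⊆A : ∀ {u v} → Adj u v → u ∈ A) where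

    -- The rotation replaces the link `w t` by `s w`. Since `w` is neither in `S` nor next to `S`,
    -- its current links are links of `P`, so `t` is next to `w` on `P`.
    rotate-once : ∀ {P S s w} → Rotated P S s → s ∈ S → Adj s w → w ∈ P →
                  w ∉ S → (∀ {z} → Consec w z P → z ∉ S) →
                  ∃[ t ] Consec w t P × Rotated P (t ∷ S) t
    rotate-once {P} {S} {s} {w} r s∈S sw w∈P w∉S away
      with Rotated.rest r | Rotated.perm r | Rotated.links r | (λ {w} → Rotated.faithful r {w})
         | ∈-∃++ (∈-resp-↭ (↭-sym (Rotated.perm r)) w∈P)
    ... | _ | perm | links | faithful | [] , ys , refl = ⊥-elim (w∉S s∈S)
    ... | _ | perm | links | faithful | .s ∷ xs , ys , refl with rotate-head s xs
    ...   | t , head , consec with head (w ∷ ys)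
    ...     | rest , eq = t , wt , record
      { rest     = rest
      ; perm     = ↭-trans (subst (_↭ s ∷ xs ++ w ∷ ys) eq (↭-sym (++↭ʳ++ (s ∷ xs) (w ∷ ys)))) perm
      ; links    = links′ ∘ split
      ; faithful = λ w∉ far c → faithful′ w∉ far (split c)
      }
      where
      wt : Consec w t P
      wt = faithful w∉S away (consec w ys)

      split : ∀ {a b} → Consec a b (t ∷ rest) →
              Consec a b (s ∷ xs) ⊎ Consec a b (w ∷ ys) ⊎ Junction a b (s ∷ xs) (w ∷ ys)
      split c = Consec-ʳ++⁻ (s ∷ xs) (subst (Consec _ _) (sym eq) c)

      links′ : ∀ {a b} → Consec a b (s ∷ xs) ⊎ Consec a b (w ∷ ys) ⊎ Junction a b (s ∷ xs) (w ∷ ys) → Adj a b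
      links′ (inj₁ c)               = links (Consec-++⁺ˡ c)
      links′ (inj₂ (inj₁ c))        = links (Consec-++⁺ʳ (s ∷ xs) c)
      links′ (inj₂ (inj₂ junction)) = sw
      links′ (inj₂ (inj₂ junction⁻¹)) = adj-sym sw

      faithful′ : ∀ {a b} → a ∉ t ∷ S → (∀ {z} → Consec a z P → z ∉ t ∷ S) →
                  Consec a b (s ∷ xs) ⊎ Consec a b (w ∷ ys) ⊎ Junction a b (s ∷ xs) (w ∷ ys) →
                  Consec a b P
      faithful′ a∉ far (inj₁ c) = faithful (a∉ ∘ there) (λ d → far d ∘ there) (Consec-++⁺ˡ c)
      faithful′ a∉ far (inj₂ (inj₁ c)) = faithful (a∉ ∘ there) (λ d → far d ∘ there) (Consec-++⁺ʳ (s ∷ xs) c)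
      -- The only new link is `s w`. Both ends are exempt: `s` lies in `S`, and `w` is next to the
      -- newly added `t` on `P`.
      faithful′ a∉ far (inj₂ (inj₂ junction)) = ⊥-elim (a∉ (there s∈S))
      faithful′ a∉ far (inj₂ (inj₂ junction⁻¹)) = ⊥-elim (far wt (here refl))

    weaken : ∀ {P S s t} → Rotated P S s → Rotated P (t ∷ S) s
    weaken r = record
      { rest = rest ; perm = perm ; links = links
      ; faithful = λ w∉ far → faithful (w∉ ∘ there) (λ d → far d ∘ there) }
      where open Rotated r

    mutual

      -- Termination is lexicographic: `d` bounds the remaining extensions of the path and `d′` the
      -- remaining growth of `S`. An extension lowers `d` and resets `d′`; a rotation keeps `d` and
      -- lowers `d′`. At zero, a list without repetition would have `n + 1` vertices.
      grow : ∀ d {p P} → length (p ∷ P) + d ≡ suc n → Unique (p ∷ P) → Links Adj (p ∷ P) →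
             p ∷ P ⊆ A → Expansion A
      grow d {p} {P} len P! links P⊆A =
        rotate d n len P! links P⊆A {p ∷ []} ([] ∷ []) z<s refl
          λ { (here refl) → record { rest = P ; perm = ↭-refl ; links = links ; faithful = λ _ _ c → c } }

      rotate : ∀ d d′ {P} → length P + d ≡ suc n → Unique P → Links Adj P → P ⊆ A →
               ∀ {S} → Unique S → 0 < length S → length S + d′ ≡ suc n →
               (∀ {s} → s ∈ S → Rotated P S s) → Expansion A
      rotate d d′ {P} len P! links P⊆A {S} S! S≠[] lenS R
        with Any.any? (λ s → Fin.any? λ w → adj? s w ×-dec ¬? (near? P S w)) S
      ... | no closed = record
        { P = P ; S = S ; P-unique = P! ; P-links = links ; P⊆A = P⊆A
        ; S-unique = S! ; S-filled = S≠[]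
        ; S⊆P = λ s∈S → ∈-resp-↭ (Rotated.perm (R s∈S)) (here refl)
        ; closed = λ {u} {v} u∈S uv → Dec.decidable-stable (near? P S v)
            λ far → closed (lose u∈S (v , uv , far))
        }
      ... | yes any with find any
      ...   | s , s∈S , w , sw , far with w ∈? P | d | d′
      ...     | no w∉P | zero | _ =
        ⊥-elim (<-irrefl (trans (sym (+-identityʳ _)) len) (s≤s (Unique-length≤ P!)))
      -- The path rotated to the endpoint `s` is extended by `w`, and rotations start afresh with
      -- `w` as the only endpoint.
      ...     | no w∉P | suc e | _ = grow e
        (trans (cong (λ k → suc (k + e)) (↭-length perm))
               (trans (sym (+-suc (length P) e)) len))
        (All.¬Any⇒All¬ _ (w∉P ∘ ∈-resp-↭ perm) ∷ Unique-↭ (↭-sym perm) P!)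
        (λ { here → adj-sym sw ; here⁻¹ → sw ; (there c) → Rotated.links r c })
        (λ { (here refl) → Adj⊆A (adj-sym sw) ; (there z∈) → P⊆A (∈-resp-↭ perm z∈) })
        where
        r = R s∈S
        perm = Rotated.perm r
      ...     | yes w∈P | _ | zero =
        ⊥-elim (<-irrefl (trans (sym (+-identityʳ _)) lenS) (s≤s (Unique-length≤ S!)))
      ...     | yes w∈P | e | suc e′ with rotate-once (R s∈S) s∈S sw w∈P (far ∘ (w∈P ,_) ∘ inj₁)
                                            (λ c z∈S → far (w∈P , inj₂ (lose z∈S c)))
      ...       | t , wt , r =
        rotate e e′ len P! links P⊆A
          -- The endpoint `t` is new: were it in `S`, then `w`, next to it on `P`, would be near
          -- `S`.
          (All.¬Any⇒All¬ _ (λ t∈S → far (w∈P , inj₂ (lose t∈S wt))) ∷ S!) z<s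
          (trans (sym (+-suc (length S) e′)) lenS)
          λ { (here refl) → r ; (there z∈S) → weaken (R z∈S) }

    expansion : ∀ {a} → a ∈ A → Expansion A
    expansion a∈A = grow n refl ([] ∷ []) (λ { (there ()) }) λ { (here refl) → a∈A }

-- Zigzags through nested chords

data Step (C : ℕ → ℕ → Set) (x y : ℕ) : Set where
  up    : y ≡ suc x → Step C x y
  down  : x ≡ suc y → Step C x y
  arc   : C x y → Step C x y
  arc⁻¹ : C y x → Step C x y

Step-sym : ∀ {C} → Step C x y → Step C y x
Step-sym (up p)    = down p
Step-sym (down p)  = up p
Step-sym (arc c)   = arc⁻¹ c
Step-sym (arc⁻¹ c) = arc c

Step-map : ∀ {C D} → (∀ {x y} → C x y → D x y) → Step C x y → Step D x y
Step-map f (up p)    = up p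
Step-map f (down p)  = down p
Step-map f (arc c)   = arc (f c)
Step-map f (arc⁻¹ c) = arc⁻¹ (f c)

-- Pairwise nested chords of the path lo, lo + 1, …, hi − 1, outermost first.
data Nest (C : ℕ → ℕ → Set) : ℕ → ℕ → Set where
  nil   : Nest C lo hi
  skipˡ : lo < hi → Nest C (suc lo) hi → Nest C lo hi
  skipʳ : lo ≤ hi → Nest C lo hi → Nest C lo (suc hi)
  chord : suc lo < hi → C lo hi → Nest C (suc lo) hi → Nest C lo (suc hi)

module _ {C : ℕ → ℕ → Set} where

  data Chord (x y : ℕ) : Nest C lo hi → Set where
    inˡ   : ∀ {p} {z : Nest C (suc lo) hi} → Chord x y z → Chord x y (skipˡ p z)
    inʳ   : ∀ {p} {z : Nest C lo hi} → Chord x y z → Chord x y (skipʳ p z)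
    inner : ∀ {p c} {z : Nest C (suc lo) hi} → Chord x y z → Chord x y (chord p c z)
    outer : ∀ {p c} {z : Nest C (suc x) y} → Chord x y (chord p c z)

  -- Both zigzags run through all chords, entering from the left and from the
  -- right respectively; between consecutive chords they follow opposite sides.
  mutual
    zigˡ : Nest C lo hi → List ℕ
    zigˡ nil                              = []
    zigˡ {lo} (skipˡ _ z)                 = lo ∷ zigˡ z
    zigˡ (skipʳ _ z)                      = zigˡ z
    zigˡ {lo} {suc hi} (chord _ _ z)      = lo ∷ hi ∷ zigʳ z

    zigʳ : Nest C lo hi → List ℕ
    zigʳ nil                              = []
    zigʳ (skipˡ _ z)                      = zigʳ z
    zigʳ {lo} {suc hi} (skipʳ _ z)        = hi ∷ zigʳ z
    zigʳ {lo} {suc hi} (chord _ _ z)      = hi ∷ lo ∷ zigˡ z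

  mutual
    zigˡ-bounds : (z : Nest C lo hi) → x ∈ zigˡ z → lo ≤ x × x < hi
    zigˡ-bounds (skipˡ p z) (here refl) = ≤-refl , p
    zigˡ-bounds (skipˡ p z) (there x∈)  = let a , b = zigˡ-bounds z x∈ in <⇒≤ a , b
    zigˡ-bounds (skipʳ p z) x∈          = let a , b = zigˡ-bounds z x∈ in a , m<n⇒m<1+n b
    zigˡ-bounds (chord p _ z) (here refl)         = ≤-refl , s≤s (<⇒≤ (<⇒≤ p))
    zigˡ-bounds (chord p _ z) (there (here refl)) = <⇒≤ (<⇒≤ p) , ≤-refl
    zigˡ-bounds (chord p _ z) (there (there x∈))  =
      let a , b = zigʳ-bounds z x∈ in <⇒≤ a , m<n⇒m<1+n b

    zigʳ-bounds : (z : Nest C lo hi) → x ∈ zigʳ z → lo ≤ x × x < hi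
    zigʳ-bounds (skipʳ p z) (here refl) = p , ≤-refl
    zigʳ-bounds (skipʳ p z) (there x∈)  = let a , b = zigʳ-bounds z x∈ in a , m<n⇒m<1+n b
    zigʳ-bounds (skipˡ p z) x∈          = let a , b = zigʳ-bounds z x∈ in <⇒≤ a , b
    zigʳ-bounds (chord p _ z) (here refl)         = <⇒≤ (<⇒≤ p) , ≤-refl
    zigʳ-bounds (chord p _ z) (there (here refl)) = ≤-refl , s≤s (<⇒≤ (<⇒≤ p))
    zigʳ-bounds (chord p _ z) (there (there x∈))  =
      let a , b = zigˡ-bounds z x∈ in <⇒≤ a , m<n⇒m<1+n b

  private
    lo∉ˡ : (z : Nest C (suc lo) hi) → lo ∉ zigˡ z
    lo∉ˡ z = <-irrefl refl ∘ proj₁ ∘ zigˡ-bounds z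

    lo∉ʳ : (z : Nest C (suc lo) hi) → lo ∉ zigʳ z
    lo∉ʳ z = <-irrefl refl ∘ proj₁ ∘ zigʳ-bounds z

    hi∉ˡ : (z : Nest C lo hi) → hi ∉ zigˡ z
    hi∉ˡ z = <-irrefl refl ∘ proj₂ ∘ zigˡ-bounds z

    hi∉ʳ : (z : Nest C lo hi) → hi ∉ zigʳ z
    hi∉ʳ z = <-irrefl refl ∘ proj₂ ∘ zigʳ-bounds z

  mutual
    zigˡ-unique : (z : Nest C lo hi) → Unique (zigˡ z)
    zigˡ-unique nil           = []
    zigˡ-unique (skipˡ _ z)   = All.¬Any⇒All¬ _ (lo∉ˡ z) ∷ zigˡ-unique z
    zigˡ-unique (skipʳ _ z)   = zigˡ-unique z
    zigˡ-unique (chord p _ z) =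
      (<⇒≢ (<⇒≤ p) ∷ All.¬Any⇒All¬ _ (lo∉ʳ z)) ∷ All.¬Any⇒All¬ _ (hi∉ʳ z) ∷ zigʳ-unique z

    zigʳ-unique : (z : Nest C lo hi) → Unique (zigʳ z)
    zigʳ-unique nil           = []
    zigʳ-unique (skipˡ _ z)   = zigʳ-unique z
    zigʳ-unique (skipʳ _ z)   = All.¬Any⇒All¬ _ (hi∉ʳ z) ∷ zigʳ-unique z
    zigʳ-unique (chord p _ z) =
      (>⇒≢ (<⇒≤ p) ∷ All.¬Any⇒All¬ _ (hi∉ˡ z)) ∷ All.¬Any⇒All¬ _ (lo∉ˡ z) ∷ zigˡ-unique z

  mutual
    -- This gives the links: a zigzag leaving a skipped position or the far end of a chord goes on
    -- at the adjacent position inside the interval, so every step other than a chord follows the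
    -- path.
    zigˡ-head : (z : Nest C lo hi) → ∀ {xs} → zigˡ z ≡ x ∷ xs → x ≡ lo
    zigˡ-head (skipˡ _ z)   refl = refl
    zigˡ-head (skipʳ _ z)   eq   = zigˡ-head z eq
    zigˡ-head (chord _ _ z) refl = refl

    zigʳ-head : (z : Nest C lo hi) → ∀ {xs} → zigʳ z ≡ x ∷ xs → hi ≡ suc x
    zigʳ-head (skipˡ _ z)   eq   = zigʳ-head z eq
    zigʳ-head (skipʳ _ z)   refl = refl
    zigʳ-head (chord _ _ z) refl = refl

  private
    step : (∀ {y ys} → zs ≡ y ∷ ys → Step C x y) → (∀ {u v} → Consec u v zs → Step C u v) →
           ∀ {u v} → Consec u v (x ∷ zs) → Step C u v
    step h t c with Consec-∷⁻ c
    ... | inj₁ (_ , _ , eq , inj₁ (refl , refl)) = h eq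
    ... | inj₁ (_ , _ , eq , inj₂ (refl , refl)) = Step-sym (h eq)
    ... | inj₂ c′ = t c′

  mutual
    zigˡ-links : (z : Nest C lo hi) → Links (Step C) (zigˡ z)
    zigˡ-links (skipˡ _ z)   = step (up ∘ zigˡ-head z) (zigˡ-links z)
    zigˡ-links (skipʳ _ z)   = zigˡ-links z
    zigˡ-links (chord _ c z) =
      step (λ { refl → arc c }) (step (down ∘ zigʳ-head z) (zigʳ-links z))

    zigʳ-links : (z : Nest C lo hi) → Links (Step C) (zigʳ z)
    zigʳ-links (skipˡ _ z)   = zigʳ-links z
    zigʳ-links (skipʳ _ z)   = step (down ∘ zigʳ-head z) (zigʳ-links z)
    zigʳ-links (chord _ c z) =
      step (λ { refl → arc⁻¹ c }) (step (up ∘ zigˡ-head z) (zigˡ-links z))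

  mutual
    zigˡ-chord : {z : Nest C lo hi} → Chord x y z → Consec x y (zigˡ z)
    zigˡ-chord (inˡ c)   = there (zigˡ-chord c)
    zigˡ-chord (inʳ c)   = zigˡ-chord c
    zigˡ-chord (inner c) = there (there (zigʳ-chord c))
    zigˡ-chord outer     = here

    zigʳ-chord : {z : Nest C lo hi} → Chord x y z → Consec x y (zigʳ z)
    zigʳ-chord (inˡ c)   = zigʳ-chord c
    zigʳ-chord (inʳ c)   = there (zigʳ-chord c)
    zigʳ-chord (inner c) = there (there (zigˡ-chord c))
    zigʳ-chord outer     = here⁻¹

  private
    at-lo : (z : Nest C lo hi) → zigˡ z ≡ y ∷ zs → SamePair i (suc i) x y → suc x ≡ lo → i ≡ x
    at-lo z eq (inj₁ (refl , _)) _ = refl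
    at-lo z eq (inj₂ (refl , refl)) refl = ⊥-elim (m+1+n≢m _ {n = 1} (trans (+-comm _ 2) (sym (zigˡ-head z eq))))

    at-hi : (z : Nest C lo hi) → zigʳ z ≡ y ∷ zs → SamePair i (suc i) hi y → suc i ≡ hi
    at-hi z eq (inj₂ (_ , q)) = q
    at-hi z eq (inj₁ (refl , refl)) = ⊥-elim (m+1+n≢m _ {n = 1} (trans (+-comm _ 2) (sym (zigʳ-head z eq))))

  -- On a skip only one zigzag visits the skipped position. After a chord the two leave from
  -- opposite ends, and from then on neither visits the end from which the other leaves.
  zig-disjoint : (z : Nest C lo hi) → Consec i (suc i) (zigˡ z) → ¬ Consec i (suc i) (zigʳ z)
  zig-disjoint (skipˡ _ z) c d with Consec-∷⁻ c
  ... | inj₂ c′ = zig-disjoint z c′ d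
  ... | inj₁ (_ , _ , eq , same) with refl ← at-lo z eq same refl = lo∉ʳ z (Consec-∈ˡ d)
  zig-disjoint (skipʳ _ z) c d with Consec-∷⁻ d
  ... | inj₂ d′ = zig-disjoint z c d′
  ... | inj₁ (_ , _ , eq , same) with refl ← at-hi z eq same = hi∉ˡ z (Consec-∈ʳ c)
  zig-disjoint (chord p _ z) here d = <-irrefl refl p
  zig-disjoint (chord p _ z) here⁻¹ d = <-asym p (m<n⇒m<1+n ≤-refl)
  zig-disjoint (chord p _ z) c here = <-asym p (m<n⇒m<1+n ≤-refl)
  zig-disjoint (chord p _ z) c here⁻¹ = <-irrefl refl p
  zig-disjoint (chord p _ z) (there c) (there d) with Consec-∷⁻ c | Consec-∷⁻ d
  ... | inj₂ c′ | inj₂ d′ = zig-disjoint z d′ c′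
  ... | inj₁ (_ , _ , eq , same) | inj₂ d′ with refl ← at-hi z eq same = hi∉ˡ z (Consec-∈ʳ d′)
  ... | inj₂ c′ | inj₁ (_ , _ , eq , same) with refl ← at-lo z eq same refl = lo∉ʳ z (Consec-∈ˡ c′)
  -- Both zigzags would use the pair `lo, hi` right after the chord; but a chord spans a gap, so
  -- `hi` is not `suc lo`.
  ... | inj₁ (_ , _ , eq , same) | inj₁ (_ , _ , eq′ , same′)
    with refl ← at-lo z eq′ same′ refl | refl ← at-hi z eq same = <-irrefl refl p

module _ {C D : ℕ → ℕ → Set} {q L : ℕ} (z₁ : Nest C 0 q) (z₂ : Nest D q L) where

  -- If nonempty, `zigʳ z₁` starts just below `q` and `zigˡ z₂` starts at `q`, so reversing the
  -- first makes them meet in an edge of the path.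
  join : List ℕ
  join = zigʳ z₁ ʳ++ zigˡ z₂

  join-unique : Unique join
  join-unique = Unique-↭ (++↭ʳ++ (zigʳ z₁) (zigˡ z₂))
    (Unique.++⁺ (zigʳ-unique z₁) (zigˡ-unique z₂)
      λ (x∈₁ , x∈₂) → <⇒≱ (proj₂ (zigʳ-bounds z₁ x∈₁)) (proj₁ (zigˡ-bounds z₂ x∈₂)))

  join-bound : q ≤ L → x ∈ join → x < L
  join-bound q≤L x∈ with ∈-ʳ++⁻ (zigʳ z₁) x∈
  ... | inj₁ x∈₁ = <-≤-trans (proj₂ (zigʳ-bounds z₁ x∈₁)) q≤L
  ... | inj₂ x∈₂ = proj₂ (zigˡ-bounds z₂ x∈₂)

  join-links : Links (Step (λ x y → C x y ⊎ D x y)) join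
  join-links {u} {v} c with Consec-ʳ++⁻ (zigʳ z₁) c
  ... | inj₁ c₁        = Step-map inj₁ (zigʳ-links z₁ c₁)
  ... | inj₂ (inj₁ c₂) = Step-map inj₂ (zigˡ-links z₂ c₂)
  ... | inj₂ (inj₂ j)  = junct j refl refl
    where
    junct : ∀ {xs ys} → Junction u v xs ys → zigʳ z₁ ≡ xs → zigˡ z₂ ≡ ys →
            Step (λ x y → C x y ⊎ D x y) u v
    junct junction eq₁ eq₂ = up (trans (zigˡ-head z₂ eq₂) (zigʳ-head z₁ eq₁))
    junct junction⁻¹ eq₁ eq₂ = down (trans (zigˡ-head z₂ eq₂) (zigʳ-head z₁ eq₁))

  join-chord₁ : Chord x y z₁ → Consec x y join
  join-chord₁ = Consec-ʳ++⁺ˡ ∘ zigʳ-chord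

  join-chord₂ : Chord x y z₂ → Consec x y join
  join-chord₂ = Consec-ʳ++⁺ʳ (zigʳ z₁) ∘ zigˡ-chord

  -- Within `z₁` this is `zig-disjoint`; any other pair of `join` has a position at least `q`, out
  -- of reach of `zigˡ z₁`.
  join-disjoint₁ : Consec i (suc i) join → ¬ Consec i (suc i) (zigˡ z₁)
  join-disjoint₁ c d with Consec-ʳ++⁻ (zigʳ z₁) c
  ... | inj₁ c₁        = zig-disjoint z₁ d c₁
  ... | inj₂ (inj₁ c₂) =
    <⇒≱ (proj₂ (zigˡ-bounds z₁ (Consec-∈ˡ d))) (proj₁ (zigˡ-bounds z₂ (Consec-∈ˡ c₂)))
  ... | inj₂ (inj₂ j) with Junction-∈ j
  ...   | inj₁ (_ , ∈₂) =
    <⇒≱ (proj₂ (zigˡ-bounds z₁ (Consec-∈ʳ d))) (proj₁ (zigˡ-bounds z₂ ∈₂))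
  ...   | inj₂ (_ , ∈₂) =
    <⇒≱ (proj₂ (zigˡ-bounds z₁ (Consec-∈ˡ d))) (proj₁ (zigˡ-bounds z₂ ∈₂))

  join-disjoint₂ : Consec i (suc i) join → ¬ Consec i (suc i) (zigʳ z₂)
  join-disjoint₂ c d with Consec-ʳ++⁻ (zigʳ z₁) c
  ... | inj₁ c₁        =
    <⇒≱ (proj₂ (zigʳ-bounds z₁ (Consec-∈ˡ c₁))) (proj₁ (zigʳ-bounds z₂ (Consec-∈ˡ d)))
  ... | inj₂ (inj₁ c₂) = zig-disjoint z₂ c₂ d
  ... | inj₂ (inj₂ j) with Junction-∈ j
  ...   | inj₁ (∈₁ , _) =
    <⇒≱ (proj₂ (zigʳ-bounds z₁ ∈₁)) (proj₁ (zigʳ-bounds z₂ (Consec-∈ˡ d)))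
  ...   | inj₂ (∈₁ , _) =
    <⇒≱ (proj₂ (zigʳ-bounds z₁ ∈₁)) (proj₁ (zigʳ-bounds z₂ (Consec-∈ʳ d)))

-- Weight classes of ranked chords.

cut : (r : ℕ → ℕ) → (∀ {x y} → x ≤ y → r x ≤ r y) → ∀ c L →
      ∃[ q ] q ≤ L × (∀ {i} → i < L → r i ≤ c → i < q) × (∀ {i} → c < r i → q ≤ i)
cut r mono c zero = 0 , z≤n , (λ ()) , λ _ → z≤n
cut r mono c (suc L) with r L ≤? c
-- By monotonicity all positions up to `L` have rank at most `c`, so the cut is at the very end.
... | yes rL≤c = suc L , ≤-refl , (λ i< _ → i<) , λ c<ri → ≰⇒> λ i≤L → <⇒≱ c<ri (≤-trans (mono i≤L) rL≤c)
... | no  rL≰c with cut r mono c L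
...   | q , q≤L , below , above = q , m≤n⇒m≤1+n q≤L , below′ , above
  where
  below′ : ∀ {i} → i < suc L → r i ≤ c → i < q
  below′ (s≤s i≤L) ri≤c = below (≤∧≢⇒< i≤L λ { refl → rL≰c ri≤c }) ri≤c

-- E is a set of chords of the path 0, 1, …, L − 1, and r ranks the positions.
record Ranked (E : ℕ → ℕ → Set) (L m : ℕ) : Set where
  field
    E?        : Decidable E
    E-gap     : E x y → suc x < y
    E-bound   : E x y → y < L
    r         : ℕ → ℕ
    r-mono    : x ≤ y → r x ≤ r y
    r-strictˡ : E x y → x < u → r x < r u
    r-strictʳ : E x y → y < u → r y < r u
    r-bound   : E x y → r y < m

module _ {E : ℕ → ℕ → Set} {L m : ℕ} (ranked : Ranked E L m) where
  open Ranked ranked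

  -- Chords of equal weight r x + (1 + b) r y are nested; the weights for
  -- b = 0 and b = 1 together determine the chord.
  weight : ℕ → ℕ → ℕ → ℕ
  weight b x y = r x + suc b * r y

  Class : ℕ → ℕ → ℕ → ℕ → Set
  Class b k x y = E x y × weight b x y ≡ k

  private
    E-< : E x y → x < y
    E-< = <⇒≤ ∘ E-gap

    weight-monoʳ : ∀ b {x} → y ≤ v → weight b x y ≤ weight b x v
    weight-monoʳ b {x} y≤v = +-monoʳ-≤ (r x) (*-monoʳ-≤ (suc b) (r-mono y≤v))

    weight-monoˡ : ∀ b {y} → x ≤ u → weight b x y ≤ weight b u y
    weight-monoˡ b x≤u = +-monoˡ-≤ _ (r-mono x≤u)

  -- A sweep from both ends with `d` as fuel. If the pair of extreme positions weighs less than `k`,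
  -- so does every pair starting at the left end, which is skipped; if it weighs more, the right end
  -- is skipped. If it weighs `k` and is a chord, no other chord of the class uses either end,
  -- because `r` is strict at ends of chords.
  nest : ∀ b k d lo hi → hi ≤ lo + d →
         Σ[ z ∈ Nest (Class b k) lo hi ] (∀ {x y} → lo ≤ x → y < hi → Class b k x y → Chord x y z)
  nest b k d lo zero _ = nil , λ _ ()
  nest b k zero lo (suc hi) hi≤ = nil , λ lo≤x y<hi (e , _) →
    ⊥-elim (<⇒≱ (≤-<-trans lo≤x (E-< e))
      (≤-pred (<-≤-trans y<hi (≤-trans hi≤ (≤-trans (≤-reflexive (+-identityʳ lo)) (n≤1+n lo))))))
  nest b k (suc d) lo (suc hi) hi≤ with lo <? hi
  ... | no lo≮hi = nil , λ { lo≤x (s≤s y≤hi) (e , _) →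
    ⊥-elim (lo≮hi (≤-<-trans lo≤x (<-≤-trans (E-< e) y≤hi))) }
  ... | yes lo<hi with <-cmp (weight b lo hi) k
  ...   | tri< w<k _ _ =
    let z , cover = nest b k d (suc lo) (suc hi) (subst (suc hi ≤_) (+-suc lo d) hi≤) in
    skipˡ (m<n⇒m<1+n lo<hi) z , λ { lo≤x (s≤s y≤hi) (e , w) → inˡ (cover
      (≤∧≢⇒< lo≤x λ { refl → <⇒≱ w<k (subst (_≤ weight b lo hi) w (weight-monoʳ b y≤hi)) })
      (s≤s y≤hi) (e , w)) }
  ...   | tri> _ _ k<w =
    let z , cover = nest b k d lo hi (≤-pred (subst (suc hi ≤_) (+-suc lo d) hi≤)) in
    skipʳ (<⇒≤ lo<hi) z , λ { lo≤x (s≤s y≤hi) (e , w) → inʳ (cover lo≤x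
      (≤∧≢⇒< y≤hi λ { refl → <⇒≱ k<w (subst (weight b lo hi ≤_) w (weight-monoˡ b lo≤x)) })
      (e , w)) }
  ...   | tri≈ _ w≡k _ with E? lo hi
  -- A chord of weight `k` at `lo` would end before `hi`, and strictness of `r` at its right end
  -- would make it lighter than the pair `lo, hi`.
  ...     | no ¬e =
    let z , cover = nest b k d (suc lo) (suc hi) (subst (suc hi ≤_) (+-suc lo d) hi≤) in
    skipˡ (m<n⇒m<1+n lo<hi) z , λ { lo≤x (s≤s y≤hi) (e , w) → inˡ (cover
      (≤∧≢⇒< lo≤x λ { refl → <-irrefl (trans w (sym w≡k)) (+-monoʳ-< (r lo) (*-monoʳ-< (suc b)
        (r-strictʳ e (≤∧≢⇒< y≤hi λ { refl → ¬e e })))) })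
      (s≤s y≤hi) (e , w)) }
  ...     | yes e₀ =
    let z , cover = nest b k d (suc lo) hi (<⇒≤ (subst (suc hi ≤_) (+-suc lo d) hi≤)) in
    chord (E-gap e₀) (e₀ , w≡k) z , covers z cover
    where
    covers : ∀ z → (∀ {x y} → suc lo ≤ x → y < hi → Class b k x y → Chord x y z) →
             ∀ {x y} → lo ≤ x → y < suc hi → Class b k x y → Chord x y (chord (E-gap e₀) (e₀ , w≡k) z)
    covers z cover {x} {y} lo≤x (s≤s y≤hi) (e , w) with lo ≟ x | y ≟ hi
    ... | yes refl | yes refl = outer
    ... | yes refl | no  y≢hi = ⊥-elim (<-irrefl (trans w (sym w≡k))
      (+-monoʳ-< (r lo) (*-monoʳ-< (suc b) (r-strictʳ e (≤∧≢⇒< y≤hi y≢hi)))))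
    ... | no  lo≢x | yes refl = ⊥-elim (<-irrefl (trans w≡k (sym w))
      (+-monoˡ-< (suc b * r hi) (r-strictˡ e₀ (≤∧≢⇒< lo≤x lo≢x))))
    ... | no  lo≢x | no  y≢hi = inner (cover (≤∧≢⇒< lo≤x lo≢x) (≤∧≢⇒< y≤hi y≢hi) (e , w))

  -- The rank `c` keeps the chords of the two classes on disjoint intervals, so a single path can
  -- serve both classes.
  record Pair (b k l c : ℕ) : Set where
    field
      below  : Class b k x y → r y ≤ c
      above  : Class b l x y → c < r x
      q      : ℕ
      q≤L    : q ≤ L
      z₁     : Nest (Class b k) 0 q
      z₂     : Nest (Class b l) q L
      cover₁ : Class b k x y → Chord x y z₁
      cover₂ : Class b l x y → Chord x y z₂

    joint : List ℕ
    joint = join z₁ z₂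

  pair : ∀ b k l c → (∀ {x y} → Class b k x y → r y ≤ c) → (∀ {x y} → Class b l x y → c < r x) →
         Pair b k l c
  pair b k l c below above with cut r r-mono c L
  ... | q , q≤L , inside , outside with nest b k q 0 q ≤-refl | nest b l L q L (m≤n+m L q)
  ...   | z₁ , cover₁ | z₂ , cover₂ = record
    { below = below ; above = above ; q = q ; q≤L = q≤L ; z₁ = z₁ ; z₂ = z₂
    ; cover₁ = λ c₁@(e , _) → cover₁ z≤n (inside (E-bound e) (below c₁)) c₁
    ; cover₂ = λ c₂@(e , _) → cover₂ (outside (above c₂)) (E-bound e) c₂
    }

  Arc-path : List ℕ → Set
  Arc-path xs = Unique xs × Links (Step E) xs × (∀ {x} → x ∈ xs → x < L)

  private
    joint-path : ∀ {b k l c} (p : Pair b k l c) → Arc-path (Pair.joint p)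
    joint-path p = join-unique z₁ z₂ , Step-map [ proj₁ , proj₁ ]′ ∘ join-links z₁ z₂
                 , join-bound z₁ z₂ q≤L
      where open Pair p

    zigˡ-path : ∀ {b k l c} (p : Pair b k l c) → Arc-path (zigˡ (Pair.z₁ p))
    zigˡ-path p = zigˡ-unique z₁ , Step-map proj₁ ∘ zigˡ-links z₁
                , λ x∈ → <-≤-trans (proj₂ (zigˡ-bounds z₁ x∈)) q≤L
      where open Pair p

    zigʳ-path : ∀ {b k l c} (p : Pair b k l c) → Arc-path (zigʳ (Pair.z₂ p))
    zigʳ-path p = zigʳ-unique z₂ , Step-map proj₁ ∘ zigʳ-links z₂ , proj₂ ∘ zigʳ-bounds z₂
      where open Pair p

    arc-only : ∀ {C : ℕ → ℕ → Set} → (∀ {x y} → C x y → E x y) → E u v → Step C u v → C u v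
    arc-only C⊆E e (up refl)   = ⊥-elim (<-irrefl refl (E-gap e))
    arc-only C⊆E e (down refl) = ⊥-elim (<-asym (E-gap e) (m<n⇒m<1+n ≤-refl))
    arc-only C⊆E e (arc c)     = c
    arc-only C⊆E e (arc⁻¹ c)   = ⊥-elim (<-asym (E-< e) (E-< (C⊆E c)))

    weight₁ : ∀ x y → weight 1 x y ≡ weight 0 x y + r y
    weight₁ x y = trans (cong (λ t → r x + (r y + t)) (+-comm (r y) 0))
      (trans (cong (λ t → r x + t) (sym (cong (_+ r y) (+-identityʳ (r y)))))
             (sym (+-assoc (r x) (r y + 0) (r y))))

    weight₀ : ∀ x y → weight 0 x y ≡ r x + r y
    weight₀ x y = cong (r x +_) (+-identityʳ (r y))

    r-< : E x y → r x < r y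
    r-< e = r-strictˡ e (E-< e)

    -- The two weights differ by `r y`, so they determine both ranks; strictness at chord ends turns
    -- equal ranks into equal positions.
    weights-injective : E x y → E u v → weight 0 x y ≡ weight 0 u v →
                        weight 1 x y ≡ weight 1 u v → x ≡ u × y ≡ v
    weights-injective {x} {y} {u} {v} e f eq₀ eq₁ = x≡u , y≡v
      where
      ry≡rv : r y ≡ r v
      ry≡rv = +-cancelˡ-≡ (weight 0 x y) (r y) (r v)
        (trans (sym (weight₁ x y)) (trans eq₁ (trans (weight₁ u v) (cong (_+ r v) (sym eq₀)))))
      rx≡ru : r x ≡ r u
      rx≡ru = +-cancelʳ-≡ (1 * r y) (r x) (r u) (trans eq₀ (cong (λ t → r u + 1 * t) (sym ry≡rv)))
      x≡u : x ≡ u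
      x≡u with <-cmp x u
      ... | tri< x<u _ _ = ⊥-elim (<-irrefl rx≡ru (r-strictˡ e x<u))
      ... | tri≈ _ p _   = p
      ... | tri> _ _ u<x = ⊥-elim (<-irrefl (sym rx≡ru) (r-strictˡ f u<x))
      y≡v : y ≡ v
      y≡v with <-cmp y v
      ... | tri< y<v _ _ = ⊥-elim (<-irrefl ry≡rv (r-strictʳ e y<v))
      ... | tri≈ _ p _   = p
      ... | tri> _ _ v<y = ⊥-elim (<-irrefl (sym ry≡rv) (r-strictʳ f v<y))

    -- Weight `k` forces `r y ≤ k`, and weight `m + k` with `r y < m` forces `k < r x`. For `k < m`
    -- these pairs exhaust all sums below `2 * m`.
    sumPair : ∀ k → Pair 0 k (m + k) k
    sumPair k = pair 0 k (m + k) k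
      (λ { {x} {y} (_ , refl) → ≤-trans (m≤n+m (r y) (r x)) (≤-reflexive (sym (weight₀ x y))) })
      (λ { {x} {y} (e , w) → +-cancelˡ-< m k (r x) (begin-strict
        m + k      ≡⟨ trans (sym w) (weight₀ x y) ⟩
        r x + r y  <⟨ +-monoʳ-< (r x) (r-bound e) ⟩
        r x + m    ≡⟨ +-comm (r x) m ⟩
        m + r x    ∎) })
      where open ≤-Reasoning

    -- As r y < m, weight 2 m + ⌊ l /2⌋ forces ⌊ l /2⌋ < r x, whereas weight l
    -- forces r y ≤ ⌊ l /2⌋.
    skewPair : ∀ l → Pair 1 l (2 * m + ⌊ l /2⌋) ⌊ l /2⌋
    skewPair l = pair 1 l (2 * m + ⌊ l /2⌋) ⌊ l /2⌋
      (λ { {x} {y} (_ , refl) → begin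
        r y                    ≡⟨ n≡⌊n+n/2⌋ (r y) ⟩
        ⌊ r y + r y /2⌋        ≡⟨ cong (λ t → ⌊ r y + t /2⌋) (sym (+-identityʳ (r y))) ⟩
        ⌊ 2 * r y /2⌋          ≤⟨ ⌊n/2⌋-mono (m≤n+m (2 * r y) (r x)) ⟩
        ⌊ weight 1 x y /2⌋     ∎ })
      (λ { {x} {y} (e , w) → +-cancelˡ-< (2 * m) ⌊ l /2⌋ (r x) (begin-strict
        2 * m + ⌊ l /2⌋    ≡⟨ sym w ⟩
        r x + 2 * r y      <⟨ +-monoʳ-< (r x) (*-monoʳ-< 2 (r-bound e)) ⟩
        r x + 2 * m        ≡⟨ +-comm (r x) (2 * m) ⟩
        2 * m + r x        ∎) })
      where open ≤-Reasoning

    -- Each class has two zigzags. The joined path supplies one for either class, so three paths do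
    -- for two classes.
    sumPaths : ℕ → List (List ℕ)
    sumPaths k = Pair.joint (sumPair k) ∷ zigˡ (Pair.z₁ (sumPair k)) ∷ zigʳ (Pair.z₂ (sumPair k)) ∷ []

    skewPath : ℕ → List ℕ
    skewPath l = Pair.joint (skewPair l)

    -- `P` is a joined path and may carry chords of two sums; `Q` is a single zigzag and fixes the
    -- sum.
    record SumSeparated (x y : ℕ) : Set where
      field
        k        : ℕ
        k<m      : k < m
        P Q      : List ℕ
        P∈       : P ∈ sumPaths k
        Q∈       : Q ∈ sumPaths k
        in-P     : Consec x y P
        in-Q     : Consec x y Q
        disjoint : ∀ {i} → Consec i (suc i) P → ¬ Consec i (suc i) Q
        Q-class  : E u v → Consec u v Q → weight 0 u v ≡ weight 0 x y

    sumSeparated : E x y → SumSeparated x y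
    sumSeparated {x} {y} e with weight 0 x y <? m
    ... | yes w<m = record
      { k = weight 0 x y ; k<m = w<m ; P∈ = here refl ; Q∈ = there (here refl)
      ; in-P = join-chord₁ z₁ z₂ (cover₁ (e , refl)) ; in-Q = zigˡ-chord (cover₁ (e , refl))
      ; disjoint = join-disjoint₁ z₁ z₂
      ; Q-class = λ f c → proj₂ (arc-only proj₁ f (zigˡ-links z₁ c)) }
      where open Pair (sumPair (weight 0 x y))
    ... | no w≮m = record
      { k = k
      ; k<m = +-cancelˡ-< m k m (begin-strict
          m + k         ≡⟨ m+k ⟩
          weight 0 x y  ≡⟨ weight₀ x y ⟩
          r x + r y     <⟨ +-mono-< (<-trans (r-< e) (r-bound e)) (r-bound e) ⟩
          m + m         ∎)
      ; P∈ = here refl ; Q∈ = there (there (here refl))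
      ; in-P = join-chord₂ z₁ z₂ (cover₂ (e , sym m+k)) ; in-Q = zigʳ-chord (cover₂ (e , sym m+k))
      ; disjoint = join-disjoint₂ z₁ z₂
      ; Q-class = λ f c → trans (proj₂ (arc-only proj₁ f (zigʳ-links z₂ c))) m+k }
      where
      -- The chord belongs to the second class of `sumPair k`; `k < m` because both ranks are below
      -- `m`.
      k = weight 0 x y ∸ m
      m+k : m + k ≡ weight 0 x y
      m+k = m+[n∸m]≡n (≮⇒≥ w≮m)
      open Pair (sumPair k) hiding (q)
      open ≤-Reasoning

    -- Chords of the first class of a pair lie to the left of those of the second.
    left : ∀ {l} → Class 1 l x y → Class 1 (2 * m + ⌊ l /2⌋) u v → weight 0 x y < weight 0 u v
    left {x} {y} {u} {v} {l} c@(e , _) d@(f , _) =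
      subst₂ _<_ (sym (weight₀ x y)) (sym (weight₀ u v))
        (+-mono-< (<-trans (r-< e) ry<ru) (<-trans ry<ru (r-< f)))
      where
      ry<ru : r y < r u
      ry<ru = ≤-<-trans (Pair.below (skewPair l) c) (Pair.above (skewPair l) d)

    -- A skew path carries two classes, but by `left` chords from different ones have different
    -- sums.
    same-class : ∀ {l} → let l′ = 2 * m + ⌊ l /2⌋ in
                 Class 1 l x y ⊎ Class 1 l′ x y → Class 1 l u v ⊎ Class 1 l′ u v →
                 weight 0 x y ≡ weight 0 u v → weight 1 x y ≡ weight 1 u v
    same-class (inj₁ (_ , p)) (inj₁ (_ , q)) _  = trans p (sym q)
    same-class (inj₂ (_ , p)) (inj₂ (_ , q)) _  = trans p (sym q)
    same-class (inj₁ c)       (inj₂ d)       eq = ⊥-elim (<-irrefl eq (left c d))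
    same-class (inj₂ c)       (inj₁ d)       eq = ⊥-elim (<-irrefl (sym eq) (left d c))

    record SkewSeparated (x y : ℕ) : Set where
      field
        l       : ℕ
        l<2m    : l < 2 * m
        in-N    : Consec x y (skewPath l)
        N-class : E u v → Consec u v (skewPath l) → weight 0 x y ≡ weight 0 u v →
                  weight 1 x y ≡ weight 1 u v

    skewSeparated : E x y → SkewSeparated x y
    skewSeparated {x} {y} e with weight 1 x y <? 2 * m
    ... | yes w<2m = record
      { l = weight 1 x y ; l<2m = w<2m
      ; in-N = join-chord₁ z₁ z₂ (cover₁ (e , refl))
      ; N-class = λ f c → same-class (inj₁ (e , refl)) (arc-only [ proj₁ , proj₁ ]′ f (join-links z₁ z₂ c)) }
      where open Pair (skewPair (weight 1 x y))
    ... | no w≮2m = record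
      -- The second class of `skewPair l` has weight `2 * m + ⌊ l /2⌋`, which is `2 * m + t` for
      -- this `l`.
      { l = t + t
      ; l<2m = subst (t + t <_) (cong (m +_) (sym (+-identityʳ m))) (+-mono-< t<m t<m)
      ; in-N = join-chord₂ z₁ z₂ (cover₂ (e , w≡))
      ; N-class = λ f c → same-class (inj₂ (e , w≡)) (arc-only [ proj₁ , proj₁ ]′ f (join-links z₁ z₂ c)) }
      where
      t = weight 1 x y ∸ 2 * m
      2m+t : 2 * m + t ≡ weight 1 x y
      2m+t = m+[n∸m]≡n (≮⇒≥ w≮2m)
      w≡ : weight 1 x y ≡ 2 * m + ⌊ t + t /2⌋
      w≡ = trans (sym 2m+t) (cong (2 * m +_) (n≡⌊n+n/2⌋ t))
      open Pair (skewPair (t + t))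
      open ≤-Reasoning
      t<m : t < m
      t<m = +-cancelˡ-< (2 * m) t m (begin-strict
        2 * m + t      ≡⟨ 2m+t ⟩
        r x + 2 * r y  <⟨ +-mono-< (<-trans (r-< e) (r-bound e)) (*-monoʳ-< 2 (r-bound e)) ⟩
        m + 2 * m      ≡⟨ +-comm m (2 * m) ⟩
        2 * m + m      ∎)

  arcPaths : List (List ℕ)
  arcPaths = concat (map sumPaths (upTo m)) ++ map skewPath (upTo (2 * m))

  arcPaths-valid : All Arc-path arcPaths
  arcPaths-valid = All.++⁺
    (All.concat⁺ (All.map⁺ (All.universal (λ k →
      joint-path (sumPair k) ∷ zigˡ-path (sumPair k) ∷ zigʳ-path (sumPair k) ∷ []) (upTo m))))
    (All.map⁺ (All.universal (λ l → joint-path (skewPair l)) (upTo (2 * m))))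

  length-arcPaths : length arcPaths ≡ 5 * m
  length-arcPaths = begin
    length arcPaths
      ≡⟨ length-++ (concat (map sumPaths (upTo m))) ⟩
    length (concat (map sumPaths (upTo m))) + length (map skewPath (upTo (2 * m)))
      ≡⟨ cong₂ _+_ (length-concat-map 3 sumPaths (λ _ → refl) (upTo m))
                   (length-map skewPath (upTo (2 * m))) ⟩
    3 * length (upTo m) + length (upTo (2 * m))
      ≡⟨ cong₂ (λ s t → 3 * s + t) (length-upTo m) (length-upTo (2 * m)) ⟩
    3 * m + 2 * m
      ≡⟨ sym (*-distribʳ-+ m 3 2) ⟩
    5 * m ∎
    where open ≡-Reasoning

  -- A pair on all of `P`, `Q` and `skewPath l` is no edge of the underlying path, as `P` and `Q`
  -- share none; and if it is a chord, it has both weights of `x, y` and is that chord. So one of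
  -- the three avoids `u, v`.
  arcPaths-separate : E x y → ¬ SamePair x y u v → ∃[ P ] P ∈ arcPaths × Consec x y P × ¬ Consec u v P
  arcPaths-separate {x} {y} {u} {v} e ≉ with sumSeparated e | skewSeparated e
  ... | s | t = choose
    where
    open SumSeparated s
    open SkewSeparated t

    sum∈ : ∀ {R} → R ∈ sumPaths k → R ∈ arcPaths
    sum∈ R∈ = ∈-++⁺ˡ (∈-concat⁺′ R∈ (∈-map⁺ sumPaths (∈-upTo⁺ k<m)))

    skew∈ : skewPath l ∈ arcPaths
    skew∈ = ∈-++⁺ʳ _ (∈-map⁺ skewPath (∈-upTo⁺ l<2m))

    only : E u′ v′ → Consec u′ v′ Q → Consec u′ v′ (skewPath l) → x ≡ u′ × y ≡ v′
    only f cQ cN = weights-injective e f w₀ (N-class f cN w₀)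
      where w₀ = sym (Q-class f cQ)

    clash : Consec u v P → Consec u v Q → Consec u v (skewPath l) → ⊥
    clash cP cQ cN with proj₁ (proj₂ (joint-path (skewPair l))) cN
    ... | up refl   = disjoint cP cQ
    ... | down refl = disjoint (Consec-sym cP) (Consec-sym cQ)
    ... | arc f     = ≉ (inj₁ (only f cQ cN))
    ... | arc⁻¹ f   = ≉ (inj₂ (only f (Consec-sym cQ) (Consec-sym cN)))

    choose : ∃[ P ] P ∈ arcPaths × Consec x y P × ¬ Consec u v P
    choose with Consec? _≟_ u v P | Consec? _≟_ u v Q | Consec? _≟_ u v (skewPath l)
    ... | no ¬c | _     | _     = P , sum∈ P∈ , in-P , ¬c
    ... | _     | no ¬c | _     = Q , sum∈ Q∈ , in-Q , ¬c
    ... | _     | _     | no ¬c = skewPath l , skew∈ , in-N , ¬c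
    ... | yes c | yes d | yes f = ⊥-elim (clash c d f)

-- The edges at an expansion

at : A → List A → ℕ → A
at d []       _       = d
at d (x ∷ xs) zero    = x
at d (x ∷ xs) (suc i) = at d xs i

at-∈⁺ : i < length xs → at d xs i ∈ xs
at-∈⁺ {zero}  {xs = _ ∷ _} _       = here refl
at-∈⁺ {suc i} {xs = _ ∷ _} (s≤s p) = there (at-∈⁺ p)

at-∈⁻ : x ∈ xs → ∃[ i ] i < length xs × at d xs i ≡ x
at-∈⁻ (here refl) = 0 , z<s , refl
at-∈⁻ (there x∈)  = let i , i< , eq = at-∈⁻ x∈ in suc i , s≤s i< , eq

at-injective : Unique xs → i < length xs → j < length xs → at d xs i ≡ at d xs j → i ≡ j
at-injective {i = zero}  {j = zero}  (_ ∷ _) _ _ _ = refl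
at-injective {i = zero}  {j = suc j} (x∉ ∷ _) _ (s≤s q) eq = ⊥-elim (All.lookup x∉ (at-∈⁺ q) eq)
at-injective {i = suc i} {j = zero}  (x∉ ∷ _) (s≤s p) _ eq = ⊥-elim (All.lookup x∉ (at-∈⁺ p) (sym eq))
at-injective {i = suc i} {j = suc j} (_ ∷ u) (s≤s p) (s≤s q) eq = cong suc (at-injective u p q eq)

at-Consec : suc i < length xs → Consec (at d xs i) (at d xs (suc i)) xs
at-Consec {zero}  {xs = _ ∷ []}    (s≤s ())
at-Consec {zero}  {xs = _ ∷ _ ∷ _} _       = here
at-Consec {suc i} {xs = _ ∷ _}     (s≤s p) = there (at-Consec p)

Consec-at⁻ : Consec u v xs → ∃[ i ] suc i < length xs × SamePair u v (at d xs i) (at d xs (suc i))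
Consec-at⁻ here      = 0 , s≤s z<s , inj₁ (refl , refl)
Consec-at⁻ here⁻¹    = 0 , s≤s z<s , inj₂ (refl , refl)
Consec-at⁻ (there c) = let i , i< , same = Consec-at⁻ c in suc i , s≤s i< , same

open DecMembership _≟_ using () renaming (_∈?_ to _∈ℕ?_)

-- Filtering `downFrom i` instead of `T` counts repeated entries of `T` only once.
rank : List ℕ → ℕ → ℕ
rank T i = length (filter (_∈ℕ? T) (downFrom i))

rank-suc-∈ : ∀ {T} → i ∈ T → rank T (suc i) ≡ suc (rank T i)
rank-suc-∈ {T = T} i∈T = cong length (filter-accept (_∈ℕ? T) i∈T)

rank-≤-suc : ∀ T i → rank T i ≤ rank T (suc i)
rank-≤-suc T i with i ∈ℕ? T
... | yes _ = n≤1+n _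
... | no  _ = ≤-refl

rank-mono : ∀ T → i ≤ j → rank T i ≤ rank T j
rank-mono {i} T i≤j = go (≤⇒≤′ i≤j)
  where
  go : ∀ {j} → i ≤′ j → rank T i ≤ rank T j
  go (≤′-reflexive refl) = ≤-refl
  go (≤′-step p)         = ≤-trans (go p) (rank-≤-suc T _)

rank-strict : ∀ {T} → i ∈ T → i < j → rank T i < rank T j
rank-strict {i} {j} {T} i∈T i<j = subst (_≤ rank T j) (rank-suc-∈ i∈T) (rank-mono {suc i} T i<j)

rank-bound : ∀ {T} → i ∈ T → rank T i < length T
rank-bound {i} {T} i∈T = subst (_≤ length T) (rank-suc-∈ i∈T)
  (Unique-⊆-length (Unique.filter⁺ (_∈ℕ? T) (Unique.downFrom⁺ (suc i)))
                   (proj₂ ∘ ∈-filter⁻ (_∈ℕ? T) {xs = downFrom (suc i)}))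

module _ {n : ℕ} (G : Graph n) where
  open Graph G
  open DecMembership (Fin._≟_ {n}) using (_∈?_)

  private V = Fin n

  ValidPath : List V → Set
  ValidPath xs = Unique xs × Links Adj xs

  -- One-sided, and against all pairs of vertices instead of edges only: a family for a subgraph
  -- then also separates its edges from the deleted ones.
  Separated : List (List V) → V → V → Set
  Separated 𝒫 u v = ∀ {x y} → ¬ SamePair u v x y → ∃[ P ] P ∈ 𝒫 × Consec u v P × ¬ Consec x y P

  module _ {A : List V} (𝒳 : Expansion G A) where
    open Expansion 𝒳

    private
      L : ℕ
      L = length P

      first : ∀ (xs : List V) → 0 < length xs → V
      first (x ∷ _) _ = x

      default : V
      default = first S S-filled

      p : ℕ → V
      p = at default P

      positions : ∀ ss → ss ⊆ P →
                  Σ[ js ∈ List ℕ ] length js ≡ length ss × (∀ {i} → i < L → p i ∈ ss → i ∈ js)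
      positions []       _  = [] , refl , λ _ ()
      positions (s ∷ ss) ss⊆P with at-∈⁻ {d = default} (ss⊆P (here refl)) | positions ss (ss⊆P ∘ there)
      ... | j , j<L , pj≡s | js , len , complete = j ∷ js , cong suc len , λ where
        i<L (here pi≡s)  → here (at-injective P-unique i<L j<L (trans pi≡s (sym pj≡s)))
        i<L (there pi∈ss) → there (complete i<L pi∈ss)

      J : List ℕ
      J = proj₁ (positions S S⊆P)

      ∈J : i < L → p i ∈ S → i ∈ J
      ∈J = proj₂ (proj₂ (positions S S⊆P))

      -- By `closed`, all neighbours of `S` are found at these positions. At the ends of `P` the
      -- extra entries (`pred 0` is `0`) merely keep the count at three per vertex of `S`.
      around : ℕ → List ℕ
      around j = j ∷ suc j ∷ pred j ∷ []

      T : List ℕ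
      T = concat (map around J)

      around⊆T : i ∈ J → around i ⊆ T
      around⊆T i∈J j∈ = ∈-concat⁺′ j∈ (∈-map⁺ around i∈J)

      E : ℕ → ℕ → Set
      E x y = suc x < y × y < L × Adj (p x) (p y) × (p x ∈ S ⊎ p y ∈ S)

      E? : Decidable E
      E? x y = (suc x <? y) ×-dec (y <? L) ×-dec adj? (p x) (p y) ×-dec ((p x ∈? S) ⊎-dec (p y ∈? S))

      S⊆T : i < L → p i ∈ S → i ∈ T
      S⊆T i<L pi∈S = around⊆T (∈J i<L pi∈S) (here refl)

      neighbour∈T : j < L → p i ∈ S → Adj (p i) (p j) → j ∈ T
      neighbour∈T {j} j<L pi∈S ij with closed pi∈S ij
      ... | _ , inj₁ pj∈S = S⊆T j<L pj∈S
      ... | _ , inj₂ near with find near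
      ...   | t , t∈S , c with Consec-at⁻ {d = default} c
      ...     | k , k<L , inj₁ (pj≡ , refl) with refl ← at-injective P-unique j<L (<⇒≤ k<L) pj≡ =
        around⊆T (∈J k<L t∈S) (there (there (here refl)))
      ...     | k , k<L , inj₂ (pj≡ , refl) with refl ← at-injective P-unique j<L k<L pj≡ =
        around⊆T (∈J (<⇒≤ k<L) t∈S) (there (here refl))

      E⊆T : ∀ {x y} → E x y → x ∈ T × y ∈ T
      E⊆T (x<y , y<L , xy , inj₁ x∈S) =
        S⊆T (<-trans (<⇒≤ x<y) y<L) x∈S , neighbour∈T y<L x∈S xy
      E⊆T (x<y , y<L , xy , inj₂ y∈S) =
        neighbour∈T (<-trans (<⇒≤ x<y) y<L) y∈S (adj-sym xy) , S⊆T y<L y∈S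

      ranked : Ranked E L (length T)
      ranked = record
        { E? = E? ; E-gap = proj₁ ; E-bound = proj₁ ∘ proj₂
        ; r = rank T ; r-mono = rank-mono T
        ; r-strictˡ = rank-strict ∘ proj₁ ∘ E⊆T ; r-strictʳ = rank-strict ∘ proj₂ ∘ E⊆T
        ; r-bound = rank-bound ∘ proj₂ ∘ E⊆T
        }

      -- Empty if no edge of `P` starts at `j`, so that each entry of `J` contributes exactly two
      -- lists to `segments`.
      segment : ℕ → List ℕ
      segment j with suc j <? L
      ... | yes _ = j ∷ suc j ∷ []
      ... | no  _ = []

      segment-valid : ∀ j → Arc-path ranked (segment j)
      segment-valid j with suc j <? L
      ... | no  _   = [] , (λ ()) , λ ()
      ... | yes j<L = ((<⇒≢ ≤-refl) ∷ []) ∷ [] ∷ []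
                    , (λ { here → up refl ; here⁻¹ → down refl ; (there (there ())) })
                    , λ { (here refl) → <⇒≤ j<L ; (there (here refl)) → j<L }

      segment-Consec : suc j < L → Consec j (suc j) (segment j) ×
                       (∀ {u v} → Consec u v (segment j) → SamePair j (suc j) u v)
      segment-Consec {j} j<L with suc j <? L
      ... | no  j≮L = ⊥-elim (j≮L j<L)
      ... | yes _   = here , λ { here → inj₁ (refl , refl) ; here⁻¹ → inj₂ (refl , refl) ; (there (there ())) }

      segments : List (List ℕ)
      segments = concat (map (λ j → segment j ∷ segment (pred j) ∷ []) J)

      positionPaths : List (List ℕ)
      positionPaths = arcPaths ranked ++ segments

      positionPaths-valid : All (Arc-path ranked) positionPaths
      positionPaths-valid = All.++⁺ (arcPaths-valid ranked)
        (All.concat⁺ (All.map⁺ (All.universal (λ j → segment-valid j ∷ segment-valid (pred j) ∷ []) J)))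

      PositionSeparated : ℕ → ℕ → Set
      PositionSeparated i j =
        ∀ {a b} → ¬ SamePair i j a b → ∃[ Q ] Q ∈ positionPaths × Consec i j Q × ¬ Consec a b Q

      segment-separated : suc i < L → segment i ∈ segments → PositionSeparated i (suc i)
      segment-separated i<L ∈segs ≉ =
        segment _ , ∈-++⁺ʳ (arcPaths ranked) ∈segs , proj₁ (segment-Consec i<L) ,
        ≉ ∘ proj₂ (segment-Consec i<L)

      arc-separated : ∀ {x y} → E x y → PositionSeparated x y
      arc-separated e ≉ =
        let Q , Q∈ , c , ¬d = arcPaths-separate ranked e ≉ in Q , ∈-++⁺ˡ Q∈ , c , ¬d

      separated-sym : PositionSeparated i j → PositionSeparated j i
      separated-sym sep ≉ =
        let Q , Q∈ , c , ¬d = sep (≉ ∘ SamePair-swap) in Q , Q∈ , Consec-sym c , ¬d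

      -- Positions at distance one form an edge of `P`, listed among the segments since one end is
      -- in `S`; all others form a chord in `E`.
      position-separated : i < L → j < L → p i ∈ S → Adj (p i) (p j) → PositionSeparated i j
      position-separated {i} {j} i<L j<L i∈S ij with <-cmp i j
      ... | tri≈ _ refl _ = ⊥-elim (adj-irrefl refl ij)
      ... | tri< i<j _ _ with m≤n⇒m<n∨m≡n i<j
      ...   | inj₁ gap  = arc-separated (gap , j<L , ij , inj₁ i∈S)
      ...   | inj₂ refl = segment-separated j<L
        (∈-concat⁺′ (here refl) (∈-map⁺ _ (∈J i<L i∈S)))
      position-separated {i} {j} i<L j<L i∈S ij | tri> _ _ j<i with m≤n⇒m<n∨m≡n j<i
      ...   | inj₁ gap  = separated-sym (arc-separated (gap , i<L , adj-sym ij , inj₂ i∈S))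
      ...   | inj₂ refl = separated-sym (segment-separated i<L
        (∈-concat⁺′ (there (here refl)) (∈-map⁺ _ (∈J i<L i∈S))))

      p-injective : i < L → j < L → p i ≡ p j → i ≡ j
      p-injective = at-injective P-unique

      map-unique : ∀ {Q} → (∀ {x} → x ∈ Q → x < L) → Unique Q → Unique (map p Q)
      map-unique bound []       = []
      map-unique bound (x∉ ∷ u) =
        All.map⁺ (All.tabulate λ y∈ eq →
          All.lookup x∉ y∈ (p-injective (bound (here refl)) (bound (there y∈)) eq))
        ∷ map-unique (bound ∘ there) u

      map-valid : ∀ {Q} → Arc-path ranked Q → ValidPath (map p Q)
      map-valid {Q} (u , links , bound) = map-unique bound u , links′
        where
        step : ∀ {a b} → a < L → b < L → Step E a b → Adj (p a) (p b)
        step a<L b<L (up refl)   = P-links (at-Consec b<L)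
        step a<L b<L (down refl) = adj-sym (P-links (at-Consec a<L))
        step a<L b<L (arc e)     = proj₁ (proj₂ (proj₂ e))
        step a<L b<L (arc⁻¹ e)   = adj-sym (proj₁ (proj₂ (proj₂ e)))

        links′ : Links Adj (map p Q)
        links′ c with Consec-map⁻ p Q c
        ... | a , b , refl , refl , c′ = step (bound (Consec-∈ˡ c′)) (bound (Consec-∈ʳ c′)) (links c′)

      map-⊆P : ∀ {Q} → Arc-path ranked Q → map p Q ⊆ P
      map-⊆P (_ , _ , bound) x∈ with ∈-map⁻ p x∈
      ... | i , i∈ , refl = at-∈⁺ (bound i∈)

      map-Consec⁻ : ∀ {Q} → Arc-path ranked Q → i < L → j < L →
                    Consec (p i) (p j) (map p Q) → Consec i j Q
      map-Consec⁻ {Q = Q} (_ , _ , bound) i<L j<L c with Consec-map⁻ p Q c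
      ... | a , b , eq , eq′ , c′
        with refl ← p-injective i<L (bound (Consec-∈ˡ c′)) eq
           | refl ← p-injective j<L (bound (Consec-∈ʳ c′)) eq′ = c′

      -- A pair (x , y) not contained in P is avoided by every path, so any
      -- path through i and j will do; the pair (i , i) selects one.
      map-separated : i ≢ j → PositionSeparated i j → Separated (map (map p) positionPaths) (p i) (p j)
      map-separated {i} {j} i≢j sep {x} {y} ≉ = cases (x ∈? P) (y ∈? P)
        where
        apart : ¬ SamePair i j i i
        apart (inj₁ (_ , refl)) = i≢j refl
        apart (inj₂ (_ , refl)) = i≢j refl

        cases : Dec (x ∈ P) → Dec (y ∈ P) →
                ∃[ R ] R ∈ map (map p) positionPaths × Consec (p i) (p j) R × ¬ Consec x y R
        cases (no x∉P) _ =
          let Q , Q∈ , c , _ = sep apart in map p Q , ∈-map⁺ (map p) Q∈ , Consec-map⁺ p c ,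
          x∉P ∘ map-⊆P (All.lookup positionPaths-valid Q∈) ∘ Consec-∈ˡ
        cases _ (no y∉P) =
          let Q , Q∈ , c , _ = sep apart in map p Q , ∈-map⁺ (map p) Q∈ , Consec-map⁺ p c ,
          y∉P ∘ map-⊆P (All.lookup positionPaths-valid Q∈) ∘ Consec-∈ʳ
        cases (yes x∈P) (yes y∈P) with at-∈⁻ {d = default} x∈P | at-∈⁻ {d = default} y∈P
        ... | a , a<L , refl | b , b<L , refl =
          let Q , Q∈ , c , ¬d = sep {a} {b} (≉ ∘ Sum.map (Product.map (cong p) (cong p))
                                                         (Product.map (cong p) (cong p)))
          in map p Q , ∈-map⁺ (map p) Q∈ , Consec-map⁺ p c ,
             ¬d ∘ map-Consec⁻ (All.lookup positionPaths-valid Q∈) a<L b<L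

    expansionPaths : List (List V)
    expansionPaths = map (map p) positionPaths

    expansionPaths-valid : All ValidPath expansionPaths
    expansionPaths-valid = All.map⁺ (All.map map-valid positionPaths-valid)

    length-expansionPaths : length expansionPaths ≡ 17 * length S
    length-expansionPaths = begin
      length expansionPaths                            ≡⟨ length-map (map p) positionPaths ⟩
      length positionPaths                             ≡⟨ length-++ (arcPaths ranked) ⟩
      length (arcPaths ranked) + length segments
        ≡⟨ cong₂ _+_ (length-arcPaths ranked) (length-concat-map 2 _ (λ _ → refl) J) ⟩
      5 * length T + 2 * length J
        ≡⟨ cong (λ t → 5 * t + 2 * length J) (length-concat-map 3 around (λ _ → refl) J) ⟩
      5 * (3 * length J) + 2 * length J                ≡⟨ cong (_+ 2 * length J) (sym (*-assoc 5 3 (length J))) ⟩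
      15 * length J + 2 * length J                     ≡⟨ sym (*-distribʳ-+ (length J) 15 2) ⟩
      17 * length J                                    ≡⟨ cong (17 *_) (proj₁ (proj₂ (positions S S⊆P))) ⟩
      17 * length S                                    ∎
      where open ≡-Reasoning

    expansionPaths-separate : u ∈ S → Adj u v → Separated expansionPaths u v
    expansionPaths-separate u∈S uv
      with at-∈⁻ {d = default} (S⊆P u∈S) | at-∈⁻ {d = default} (proj₁ (closed u∈S uv))
    ... | i , i<L , refl | j , j<L , refl =
      map-separated (λ { refl → adj-irrefl refl uv }) (position-separated i<L j<L u∈S uv)

-- Induction by removing expansions.

record SeparatingFamily {n} (G : Graph n) (b : ℕ) : Set where
  open Graph G
  field
    𝒫        : List (List (Fin n))
    valid    : All (ValidPath G) 𝒫
    bound    : length 𝒫 ≤ b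
    separate : Adj u v → Separated G 𝒫 u v

module _ {n : ℕ} where
  open DecMembership (Fin._≟_ {n}) using (_∈?_)

  -- The vertices of `S` stay as isolated ones, so the paths of both graphs are lists over the same
  -- `Fin n`.
  _∖_ : Graph n → List (Fin n) → Graph n
  G ∖ S = record
    { Adj        = λ u v → Adj u v × u ∉ S × v ∉ S
    ; adj?       = λ u v → adj? u v ×-dec ¬? (u ∈? S) ×-dec ¬? (v ∈? S)
    ; adj-sym    = λ (uv , u∉S , v∉S) → adj-sym uv , v∉S , u∉S
    ; adj-irrefl = λ u≡v → adj-irrefl u≡v ∘ proj₁
    }
    where open Graph G

  -- The new paths separate the edges at `S`, and `ℱ` the remaining ones, in both cases from every
  -- other pair of vertices.
  extend : (G : Graph n) {A : List (Fin n)} (𝒳 : Expansion G A) →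
           let S = Expansion.S 𝒳 in ∀ {b} →
           SeparatingFamily (G ∖ S) b → SeparatingFamily G (17 * length S + b)
  extend G 𝒳 {b} ℱ = record
    { 𝒫 = new ++ 𝒫
    ; valid = All.++⁺ (expansionPaths-valid G 𝒳) (All.map valid-⊆ valid)
    ; bound = subst (_≤ 17 * length S + b) (sym (length-++ new))
        (+-mono-≤ (≤-reflexive (length-expansionPaths G 𝒳)) bound)
    ; separate = sep }
    where
    open Graph G
    open Expansion 𝒳 using (S)
    open SeparatingFamily ℱ
    new = expansionPaths G 𝒳

    valid-⊆ : ∀ {xs} → ValidPath (G ∖ S) xs → ValidPath G xs
    valid-⊆ (xs! , links) = xs! , λ c → proj₁ (links c)

    sep : Adj u v → Separated G (new ++ 𝒫) u v
    sep {u} {v} uv ≉ with u ∈? S | v ∈? S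
    ... | yes u∈S | _ =
      let P , P∈ , c , ¬d = expansionPaths-separate G 𝒳 u∈S uv ≉ in P , ∈-++⁺ˡ P∈ , c , ¬d
    ... | _ | yes v∈S =
      let P , P∈ , c , ¬d = expansionPaths-separate G 𝒳 v∈S (adj-sym uv) (≉ ∘ SamePair-swap)
      in P , ∈-++⁺ˡ P∈ , Consec-sym c , ¬d
    ... | no u∉S | no v∉S =
      let P , P∈ , c , ¬d = separate (uv , u∉S , v∉S) ≉ in P , ∈-++⁺ʳ new P∈ , c , ¬d

  -- Induction on the length of `A`, which contains every non-isolated vertex, with `k` as fuel.
  -- Each expansion takes its `S` out of `A`.
  separatingFamily : ∀ k (G : Graph n) A → length A ≤ k → Unique A →
                     (∀ {u v} → Graph.Adj G u v → u ∈ A) → SeparatingFamily G (17 * length A)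
  separatingFamily k G [] _ _ ⊆A = record
    { 𝒫 = [] ; valid = [] ; bound = z≤n ; separate = λ uv → ⊥-elim (¬∈[] (⊆A uv)) }
    where
    ¬∈[] : ∀ {u : Fin n} → u ∉ []
    ¬∈[] ()
  separatingFamily (suc k) G A@(_ ∷ _) |A|≤k A! ⊆A = record
    { SeparatingFamily ℱ
    ; bound = ≤-trans (SeparatingFamily.bound ℱ)
        (≤-trans (≤-reflexive (sym (*-distribˡ-+ 17 (length S) (length A′)))) (*-monoʳ-≤ 17 |S|+|A′|≤|A|)) }
    where
    𝒳 = expansion G ⊆A (here refl)
    open Expansion 𝒳
    ∉S? = λ v → ¬? (v ∈? S)
    A′ = filter ∉S? A

    -- `S` lies in `A` by way of `P` and is disjoint from `A′`. As `S` is nonempty, this also makes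
    -- `A′` shorter than `A`.
    |S|+|A′|≤|A| : length S + length A′ ≤ length A
    |S|+|A′|≤|A| = subst (_≤ length A) (length-++ S) (Unique-⊆-length
      (Unique.++⁺ S-unique (Unique.filter⁺ ∉S? A!)
        λ (v∈S , v∈A′) → proj₂ (∈-filter⁻ ∉S? {xs = A} v∈A′) v∈S)
      ([ P⊆A ∘ S⊆P , proj₁ ∘ ∈-filter⁻ ∉S? ]′ ∘ ∈-++⁻ S))

    ℱ = extend G 𝒳 (separatingFamily k (G ∖ S) A′
      (≤-pred (<-≤-trans (+-monoˡ-< (length A′) S-filled) (≤-trans |S|+|A′|≤|A| |A|≤k)))
      (Unique.filter⁺ ∉S? A!)
      λ (uv , u∉S , _) → ∈-filter⁺ ∉S? (⊆A uv) u∉S)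

-- From vertex lists to the paths of the statement.

module _ {n : ℕ} {G : Graph n} where
  open Graph G

  ∈ₚ⇒Consec : ∀ (e : Edge G) {vs} (l : Linked Adj vs) →
              Any (e ≈ₑ_) (linkedEdges {G = G} l) → Consec (Edge.src e) (Edge.tgt e) vs
  ∈ₚ⇒Consec e (_ ∷ l) (here (inj₁ (refl , refl))) = here
  ∈ₚ⇒Consec e (_ ∷ l) (here (inj₂ (refl , refl))) = here⁻¹
  ∈ₚ⇒Consec e (_ ∷ l) (there e∈)                  = there (∈ₚ⇒Consec e l e∈)

  Consec⇒∈ₚ : ∀ (e : Edge G) {vs} (l : Linked Adj vs) →
              Consec (Edge.src e) (Edge.tgt e) vs → Any (e ≈ₑ_) (linkedEdges {G = G} l)
  Consec⇒∈ₚ e [-]     (there ())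
  Consec⇒∈ₚ e (_ ∷ l) here      = here (inj₁ (refl , refl))
  Consec⇒∈ₚ e (_ ∷ l) here⁻¹    = here (inj₂ (refl , refl))
  Consec⇒∈ₚ e (_ ∷ l) (there c) = there (Consec⇒∈ₚ e l c)

  -- Empty lists, which may arise as zigzags or segments, contain no pair; they are dropped because
  -- a `Path` has at least one vertex.
  toPaths : ∀ {𝒫} → All (ValidPath G) 𝒫 → List (Path G)
  toPaths [] = []
  toPaths {[] ∷ _} (_ ∷ valid) = toPaths valid
  toPaths {(v ∷ vs) ∷ _} ((u , links) ∷ valid) =
    path (v ∷⁺ vs) u (Links⇒Linked (v ∷ vs) links) ∷ toPaths valid

  length-toPaths : ∀ {𝒫} (valid : All (ValidPath G) 𝒫) → length (toPaths valid) ≤ length 𝒫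
  length-toPaths [] = z≤n
  length-toPaths {[] ∷ _}      (_ ∷ valid) = m≤n⇒m≤1+n (length-toPaths valid)
  length-toPaths {(_ ∷ _) ∷ _} (_ ∷ valid) = s≤s (length-toPaths valid)

  toPaths-∈ : ∀ {𝒫 vs} (valid : All (ValidPath G) 𝒫) → vs ∈ 𝒫 → Consec u v vs →
              ∃[ P ] P ∈ toPaths valid × toList (Path.vertices P) ≡ vs
  toPaths-∈ {𝒫 = []      ∷ _} (_ ∷ valid) (here refl) ()
  toPaths-∈ {𝒫 = (_ ∷ _) ∷ _} (_ ∷ valid) (here refl) c = _ , here refl , refl
  toPaths-∈ {𝒫 = []      ∷ _} (_ ∷ valid) (there vs∈) c = toPaths-∈ valid vs∈ c
  toPaths-∈ {𝒫 = (_ ∷ _) ∷ _} (_ ∷ valid) (there vs∈) c =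
    let P , P∈ , eq = toPaths-∈ valid vs∈ c in P , there P∈ , eq

  toPaths-separate : ∀ {𝒫} (valid : All (ValidPath G) 𝒫) (e f : Edge G) →
                     Separated G 𝒫 (Edge.src e) (Edge.tgt e) → e ≉ₑ f →
                     ∃[ P ] P ∈ toPaths valid × e ∈ₚ P × f ∉ₚ P
  toPaths-separate valid e f sep e≉f with sep e≉f
  ... | vs , vs∈ , c , ¬d with toPaths-∈ valid vs∈ c
  ...   | P , P∈ , refl = P , P∈ , Consec⇒∈ₚ e (Path.linked P) c , ¬d ∘ ∈ₚ⇒Consec f (Path.linked P)

  ≈ₑ-sym : ∀ (e f : Edge G) → e ≈ₑ f → f ≈ₑ e
  ≈ₑ-sym _ _ (inj₁ (refl , refl)) = inj₁ (refl , refl)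
  ≈ₑ-sym _ _ (inj₂ (refl , refl)) = inj₂ (refl , refl)

theorem2 : ∀ (n : ℕ) (G : Graph n) →
    Σ (List (Path G)) λ 𝒫 → StronglySeparating 𝒫 × length 𝒫 ≤ 19 * n
theorem2 n G = toPaths valid , separating , size
  where
  open SeparatingFamily (separatingFamily n G (allFin n) (≤-reflexive (length-tabulate {n = n} id))
    (Unique.allFin⁺ n) (λ {u} _ → ∈-allFin u))

  separating : StronglySeparating (toPaths valid)
  separating e f e≉f =
    let P , P∈ , e∈P , f∉P = toPaths-separate valid e f (separate (Edge.adjacent e)) e≉f
        Q , Q∈ , f∈Q , e∉Q = toPaths-separate valid f e (separate (Edge.adjacent f)) (e≉f ∘ ≈ₑ-sym f e)
    in P , Q , P∈ , Q∈ , e∈P , e∉Q , f∈Q , f∉P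

  size : length (toPaths valid) ≤ 19 * n
  size = begin
    length (toPaths valid)  ≤⟨ length-toPaths valid ⟩
    length 𝒫                ≤⟨ bound ⟩
    17 * length (allFin n)  ≡⟨ cong (17 *_) (length-tabulate {n = n} id) ⟩
    -- The construction gives 17 paths per vertex, which is within the claimed 19.
    17 * n                  ≤⟨ *-monoˡ-≤ n (m≤m+n 17 2) ⟩
    19 * n                  ∎
    where open ≤-Reasoning
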